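{- Let $G$ be a simple bipartite super edge-magic graph with stable sets $X=\{x_i\}_{i=1}^s$ and $Y=\{y_j\}_{j=1}^t$, let $n\ge1$, and suppose $G\cong H_1\oplus H_2$ is a decomposition of $G$. Then $|\sigma_{S_{2n}(G;H_1,H_2)}|\ge (n+1)|\sigma_G|$.
   Context: A decomposition $G\cong H_1\oplus H_2$ means $H_1,H_2$ are subgraphs of $G$ whose edge sets partition $E(G)$. A super edge-magic labeling of a graph with $p$ vertices and $q$ edges is a bijection $f:V\cup E\to[1,p+q]$ with $f(V)=[1,p]$ such that $f(x)+f(xy)+f(y)$ is a constant (the valence) over all edges $xy$; here $[a,b]=\{a,\dots,b\}$. Let $S_G=\{(\sum_{u\in V}\deg(u)g(u)+\sum_{i=p+1}^{p+q}i)/q: g:V\to[1,p]\text{ bijective}\}$, $I_G=[\lceil\min S_G\rceil,\lfloor\max S_G\rfloor]$ and $\sigma_G=\{k\in I_G: k\text{ is the valence of some super edge-magic labeling of }G\}$. $S_{2n}(G;H_1,H_2)$ is the graph with vertex set $X\cup Y\cup\bigcup_{k=1}^n X_k\cup\bigcup_{k=1}^n Y_k$, where $X_k=\{x_i^k\}_{i=1}^s$, $Y_k=\{y_j^k\}_{j=1}^t$ are new vertices, and edge set $E(G)\cup\{x_iy_j^k: x_iy_j\in E(H_1),\,k\in[1,n]\}\cup\{x_i^ky_j: x_iy_j\in E(H_2),\,k\in[1,n]\}$. -}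

module Defs where

open import Data.Nat using (ℕ; zero; suc; _+_; _*_; _≤_)
open import Data.Fin using (Fin; toℕ; zero; suc; _≟_; remQuot; _↑ˡ_; _↑ʳ_)
open import Data.Bool using (Bool; true; false; _∨_; _∧_; if_then_else_)
open import Data.List using (List; []; _∷_; [_]; length; map; concatMap; allFin; upTo; lookup)
open import Data.Nat.ListAction using (sum)
open import Data.List.Relation.Unary.All using (All)
open import Data.List.Relation.Unary.Unique.Propositional using (Unique)
open import Data.Product using (_×_; _,_; proj₁; proj₂; Σ; ∃)
open import Data.Sum using (_⊎_; inj₁; inj₂)
open import Relation.Nullary using (does)
open import Relation.Binary.PropositionalEquality using (_≡_)
open import Function.Bundles using (_⤖_; Bijection)

record Graph : Set where
  field
    p     : ℕ
    edges : List (Fin p × Fin p)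

  q : ℕ
  q = length edges

  edge : Fin q → Fin p × Fin p
  edge = lookup edges

  -- degree of u: number of edges incident to u (graphs here are loopless)
  deg : Fin p → ℕ
  deg u = sum (map (λ e → if does (proj₁ e ≟ u) ∨ does (proj₂ e ≟ u) then 1 else 0) edges)

open Graph public

-- Super edge-magic labeling with valence k.
-- f : V ∪ E → [1, p+q] bijective is encoded as a bijection
-- f : Fin p ⊎ Fin q ⤖ Fin (p + q), the actual label being suc (toℕ (f x)).
-- f(V) = [1,p] means every vertex gets a label ≤ p.

record SELabeling (G : Graph) (k : ℕ) : Set where
  field
    f : (Fin (p G) ⊎ Fin (q G)) ⤖ Fin (p G + q G)

  lab : Fin (p G) ⊎ Fin (q G) → ℕ
  lab x = suc (toℕ (Bijection.to f x))

  field
    verticesLow : ∀ (v : Fin (p G)) → lab (inj₁ v) ≤ p G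
    valence     : ∀ (e : Fin (q G)) →
                  lab (inj₁ (proj₁ (edge G e))) + lab (inj₂ e) + lab (inj₁ (proj₂ (edge G e))) ≡ k

SuperEdgeMagic : Graph → Set
SuperEdgeMagic G = ∃ λ k → SELabeling G k

-- For a bijection g : V → [1,p] (encoded as Fin p ⤖ Fin p,
-- label suc (toℕ (g u))) the numerator of the element of S_G is
--   N(g) = Σ_u deg(u) g(u) + Σ_{i=p+1}^{p+q} i,  and the element is N(g)/q.

numer : (G : Graph) → (Fin (p G) ⤖ Fin (p G)) → ℕ
numer G g =
  sum (map (λ u → deg G u * suc (toℕ (Bijection.to g u))) (allFin (p G)))
  + sum (map (λ i → p G + suc i) (upTo (q G)))

-- k ∈ I_G = [⌈min S_G⌉, ⌊max S_G⌋] for an integer k: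
--   ⌈min S_G⌉ ≤ k  ⟺  min S_G ≤ k  ⟺  ∃ g, N(g) ≤ q·k
--   k ≤ ⌊max S_G⌋  ⟺  k ≤ max S_G  ⟺  ∃ g, q·k ≤ N(g)
InI : Graph → ℕ → Set
InI G k = (∃ λ (g : Fin (p G) ⤖ Fin (p G)) → numer G g ≤ q G * k)
        × (∃ λ (g : Fin (p G) ⤖ Fin (p G)) → q G * k ≤ numer G g)

InSigma : Graph → ℕ → Set
InSigma G k = InI G k × SELabeling G k

-- |σ_H| ≥ m * |σ_G| : every list of distinct elements of σ_G of length ℓ
-- yields a list of distinct elements of σ_H of length ≥ m * ℓ.
SigmaCardGe : Graph → ℕ → Graph → Set
SigmaCardGe H m G =
  ∀ (ks : List ℕ) → Unique ks → All (InSigma G) ks →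
  ∃ λ (ls : List ℕ) → Unique ls × All (InSigma H) ls × (m * length ks ≤ length ls)

-- Bipartite graphs with stable sets X = {x_i}_{i<s}, Y = {y_j}_{j<t},
-- given by an edge matrix M : Fin s → Fin t → Bool (so simple by construction).
-- Vertices: x_i ↦ i ↑ˡ t, y_j ↦ s ↑ʳ j in Fin (s + t).

BipEdges : ℕ → ℕ → Set
BipEdges s t = Fin s → Fin t → Bool

bipGraph : ∀ {s t} → BipEdges s t → Graph
bipGraph {s} {t} M = record
  { p     = s + t
  ; edges = concatMap (λ i → concatMap (λ j →
              if M i j then [ (i ↑ˡ t , s ↑ʳ j) ] else []) (allFin t)) (allFin s) }

Decomposition : ∀ {s t} → BipEdges s t → BipEdges s t → BipEdges s t → Set
Decomposition {s} {t} M M₁ M₂ =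
  ∀ (i : Fin s) (j : Fin t) → (M i j ≡ M₁ i j ∨ M₂ i j) × (M₁ i j ∧ M₂ i j ≡ false)

-- S_{2n}(G;H₁,H₂): X-side vertices Fin (suc n * s), where remQuot gives (k , i),
-- k = 0 meaning x_i and k = suc k' meaning x_i^{k'+1}; similarly on the Y side.
-- Edges: x_i y_j for x_iy_j ∈ E(G); x_i y_j^k for x_iy_j ∈ E(H₁);
-- x_i^k y_j for x_iy_j ∈ E(H₂).
S2n : ∀ {s t} (n : ℕ) → BipEdges s t → BipEdges s t → BipEdges s t →
      BipEdges (suc n * s) (suc n * t)
S2n {s} {t} n M M₁ M₂ a b with remQuot {suc n} s a | remQuot {suc n} t b
... | zero  , i | zero  , j = M i j
... | zero  , i | suc _ , j = M₁ i j
... | suc _ , i | zero  , j = M₂ i j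
... | suc _ , i | suc _ , j = false

module Submission where

-- Put N = n + 1.  The vertices of S_{2n} are N copies of those of G, and each
-- edge x_iy_j of G has exactly N copies: copy r joins x_i to y_j^r when
-- x_iy_j ∈ H₁ and x_i^r to y_j otherwise (copy 0 being x_iy_j itself).  From a
-- super edge-magic labeling (φ, ε) of G with valence k and a shift c ∈ [0,n] we
-- label copy a of a vertex v by 1 + N·φ(v) + τ(a) and copy r of an edge g by
-- 1 + p_H + N·ε(g) + (n − τ(r)), where τ swaps 0 and c.  This is super edge-magic
-- with valence K(k,c) = n + 3 + c + N(k − 3), and K is injective on pairs as k ≥ 3.

open import Defs
open import Data.Nat using (ℕ; zero; suc; _+_; _*_; _∸_; _≤_; _<_; z≤n; s≤s; s≤s⁻¹; _≟_; _<?_)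
open import Data.Nat.Properties
open import Data.Nat.DivMod using (_/_; _%_; +-distrib-/-∣ʳ; m<n⇒m/n≡0; m*n/n≡m; [m+kn]%n≡m%n; m<n⇒m%n≡m)
open import Data.Nat.Divisibility using (n∣m*n)
open import Data.Fin as F
  using (Fin; zero; suc; toℕ; fromℕ<; punchOut; join; combine; remQuot; cast; opposite; splitAt; _↑ˡ_; _↑ʳ_)
import Data.Fin.Properties as FP
open import Data.Bool using (Bool; true; false; _∨_; _∧_; if_then_else_)
open import Data.Bool.Properties using (∨-zeroʳ; ∨-identityˡ; ∧-identityʳ)
open import Data.List
  using (List; []; _∷_; map; tabulate; allFin; upTo; applyUpTo; lookup; length; concatMap; cartesianProductWith; _++_)
import Data.List.Properties as LP
open import Data.Nat.ListAction using (sum)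
open import Data.List.Relation.Unary.All as All using (All; []; _∷_)
import Data.List.Relation.Unary.All.Properties as AllP
open import Data.List.Relation.Unary.Any as Any using (here)
import Data.List.Relation.Unary.Any.Properties as AnyP
open import Data.List.Relation.Unary.Unique.Propositional using (Unique)
open import Data.List.Relation.Unary.AllPairs using ([]; _∷_)
import Data.List.Relation.Unary.Unique.Propositional.Properties as UP
open import Data.List.Membership.Propositional as Mem using (_∈_)
import Data.List.Membership.Propositional.Properties as MP
open import Data.Product using (_×_; _,_; proj₁; proj₂; ∃)
open import Data.Sum using (_⊎_; inj₁; inj₂)
open import Data.Empty using (⊥; ⊥-elim)
open import Data.Nat.Solver using (module +-*-Solver)
open import Relation.Nullary using (does; yes; no; ¬_)
open import Relation.Binary.PropositionalEquality
open import Function.Base using (_∘_; id)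
open import Function.Definitions using (Injective)
open import Function.Bundles using (_⤖_; Bijection; mk⤖)
open import Function.Construct.Composition using (_⤖-∘_)
open import Function.Construct.Symmetry using (↔-sym)
open import Function.Properties.Bijection using (⤖⇒↔)
open import Function.Properties.Inverse using (↔⇒⤖)
open import Data.Sum.Function.Propositional using (_⊎-⤖_)
import Data.Fin.Permutation as Perm
import Data.Fin.Permutation.Components as PC
open import Algebra.Properties.CommutativeMonoid.Sum +-0-commutativeMonoid
  using (∑-distrib-+; ∑-permute; sum-cong-≗; sum-replicate-zero) renaming (sum to ∑)

open Bijection using (to)

cong₃ : ∀ {A B C D : Set} (f : A → B → C → D) {a a′ b b′ c c′} →
        a ≡ a′ → b ≡ b′ → c ≡ c′ → f a b c ≡ f a′ b′ c′
cong₃ f refl refl refl = refl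

injective⇒surjective : ∀ {n} {f : Fin n → Fin n} → Injective _≡_ _≡_ f → ∀ y → ∃ λ x → f x ≡ y
injective⇒surjective {zero} _ ()
injective⇒surjective {suc n} {f} f-inj y with FP.any? (λ x → f x F.≟ y)
... | yes hit = hit
... | no miss = ⊥-elim (1+n≰n (FP.injective⇒≤ punched-injective))
  where
  -- y is missed, so f can be squeezed into Fin n by removing y
  avoids : ∀ x → y ≢ f x
  avoids x y≡fx = miss (x , sym y≡fx)
  punched-injective : Injective _≡_ _≡_ (λ x → punchOut (avoids x))
  punched-injective eq = f-inj (FP.punchOut-injective (avoids _) (avoids _) eq)

permutation : ∀ {n} (f : Fin n → Fin n) → Injective _≡_ _≡_ f → Fin n ⤖ Fin n
permutation f f-inj = mk⤖ (f-inj , λ y →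
  let x , fx≡y = injective⇒surjective f-inj y in x , λ z≡x → trans (cong f z≡x) fx≡y)

cast-injective : ∀ {m n} .(eq : m ≡ n) → Injective _≡_ _≡_ (cast eq)
cast-injective eq {i} {j} castᵢ≡castⱼ =
  FP.toℕ-injective (trans (sym (FP.toℕ-cast eq i)) (trans (cong toℕ castᵢ≡castⱼ) (FP.toℕ-cast eq j)))

opposite-injective : ∀ {n} → Injective _≡_ _≡_ (opposite {n})
opposite-injective {n} {i} {j} eq =
  trans (sym (FP.opposite-involutive i)) (trans (cong opposite eq) (FP.opposite-involutive j))

-- Finite sums.  The definitions use list sums; we compute with the vector sum ∑
-- of Algebra.Properties.CommutativeMonoid.Sum and convert with the next lemmas.

sum-tabulate : ∀ n (h : Fin n → ℕ) → sum (tabulate h) ≡ ∑ h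
sum-tabulate zero    h = refl
sum-tabulate (suc n) h = cong (h zero +_) (sum-tabulate n (h ∘ suc))

sum-allFin : ∀ n (h : Fin n → ℕ) → sum (map h (allFin n)) ≡ ∑ h
sum-allFin n h = trans (cong sum (LP.map-tabulate id h)) (sum-tabulate n h)

sum-applyUpTo : ∀ n (f : ℕ → ℕ) → sum (applyUpTo f n) ≡ ∑ {n} (f ∘ toℕ)
sum-applyUpTo zero    f = refl
sum-applyUpTo (suc n) f = cong (f 0 +_) (sum-applyUpTo n (f ∘ suc))

sum-upTo : ∀ n (f : ℕ → ℕ) → sum (map f (upTo n)) ≡ ∑ {n} (f ∘ toℕ)
sum-upTo n f = trans (cong sum (LP.map-upTo f n)) (sum-applyUpTo n f)

sum-lookup : ∀ {A : Set} (xs : List A) (h : A → ℕ) → sum (map h xs) ≡ ∑ (h ∘ lookup xs)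
sum-lookup []       h = refl
sum-lookup (x ∷ xs) h = cong (h x +_) (sum-lookup xs h)

∑-const : ∀ n c → ∑ {n} (λ _ → c) ≡ n * c
∑-const zero    c = refl
∑-const (suc n) c = cong (c +_) (∑-const n c)

∑-point : ∀ {p} (a : Fin p) (w : Fin p → ℕ) → ∑ (λ u → if does (a F.≟ u) then w u else 0) ≡ w a
∑-point {suc p} zero    w = trans (cong (w zero +_) (sum-replicate-zero p)) (+-identityʳ (w zero))
∑-point {suc p} (suc a) w = ∑-point a (w ∘ suc)

incidence : ∀ {p} → Fin p × Fin p → Fin p → ℕ
incidence e u = if does (proj₁ e F.≟ u) ∨ does (proj₂ e F.≟ u) then 1 else 0

∑-incidence : ∀ {p} (a b : Fin p) → a ≢ b → (w : Fin p → ℕ) →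
              ∑ (λ u → incidence (a , b) u * w u) ≡ w a + w b
∑-incidence a b a≢b w = begin
  ∑ (λ u → incidence (a , b) u * w u)  ≡⟨ sum-cong-≗ split ⟩
  ∑ (λ u → point a u + point b u)       ≡⟨ ∑-distrib-+ (point a) (point b) ⟩
  ∑ (point a) + ∑ (point b)             ≡⟨ cong₂ _+_ (∑-point a w) (∑-point b w) ⟩
  w a + w b                             ∎
  where
  open ≡-Reasoning
  point : Fin _ → Fin _ → ℕ
  point x u = if does (x F.≟ u) then w u else 0
  split : ∀ u → incidence (a , b) u * w u ≡ point a u + point b u
  split u with a F.≟ u | b F.≟ u
  ... | yes refl | yes refl = ⊥-elim (a≢b refl)
  ... | yes refl | no _     = trans (+-identityʳ (w u)) (sym (+-identityʳ (w u)))
  ... | no _     | yes refl = +-identityʳ (w u)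
  ... | no _     | no _     = refl

Proper : ∀ {p} → Fin p × Fin p → Set
Proper e = proj₁ e ≢ proj₂ e

Loopless : Graph → Set
Loopless G = All Proper (edges G)

handshake : ∀ {p} (es : List (Fin p × Fin p)) → All Proper es → (w : Fin p → ℕ) →
            ∑ (λ u → sum (map (λ e → incidence e u) es) * w u)
            ≡ sum (map (λ e → w (proj₁ e) + w (proj₂ e)) es)
handshake {p} []             []             w = sum-replicate-zero p
handshake     ((a , b) ∷ es) (a≢b ∷ proper) w = begin
  ∑ (λ u → (incidence (a , b) u + d u) * w u)
    ≡⟨ sum-cong-≗ (λ u → *-distribʳ-+ (w u) (incidence (a , b) u) (d u)) ⟩
  ∑ (λ u → incidence (a , b) u * w u + d u * w u)
    ≡⟨ ∑-distrib-+ (λ u → incidence (a , b) u * w u) (λ u → d u * w u) ⟩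
  ∑ (λ u → incidence (a , b) u * w u) + ∑ (λ u → d u * w u)
    ≡⟨ cong₂ _+_ (∑-incidence a b a≢b w) (handshake es proper w) ⟩
  w a + w b + sum (map (λ e → w (proj₁ e) + w (proj₂ e)) es) ∎
  where
  open ≡-Reasoning
  d : Fin _ → ℕ
  d u = sum (map (λ e → incidence e u) es)

record SEPerm (G : Graph) (k : ℕ) : Set where
  field
    φ : Fin (p G) ⤖ Fin (p G)
    ε : Fin (q G) ⤖ Fin (q G)

  vertexLabel : Fin (p G) → ℕ
  vertexLabel v = suc (toℕ (to φ v))

  edgeLabel : Fin (q G) → ℕ
  edgeLabel e = suc (p G + toℕ (to ε e))

  field
    magic : ∀ e → vertexLabel (proj₁ (edge G e)) + edgeLabel e + vertexLabel (proj₂ (edge G e)) ≡ k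

SEPerm⇒SELabeling : ∀ {G k} → SEPerm G k → SELabeling G k
SEPerm⇒SELabeling {G} L = record
  { f           = ↔⇒⤖ (↔-sym FP.+↔⊎) ⤖-∘ (φ ⊎-⤖ ε)
  ; verticesLow = λ v → subst (λ l → suc l ≤ p G) (sym (FP.toℕ-↑ˡ (to φ v) (q G))) (FP.toℕ<n (to φ v))
  ; valence     = λ e → trans (cong₃ (λ a l b → suc a + suc l + suc b)
                                     (FP.toℕ-↑ˡ (to φ (proj₁ (edge G e))) (q G))
                                     (FP.toℕ-↑ʳ (p G) (to ε e))
                                     (FP.toℕ-↑ˡ (to φ (proj₂ (edge G e))) (q G)))
                              (magic e)
  }
  where open SEPerm L

-- Every super edge-magic labeling has a permutation form: the vertices take
-- exactly the labels [1,p], hence the edges take exactly the labels [p+1,p+q].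
module PermutationForm {G : Graph} {k : ℕ} (L : SELabeling G k) where
  open SELabeling L

  P : ℕ
  P = p G

  -- the label minus one, as a natural number
  label : Fin P ⊎ Fin (q G) → ℕ
  label x = toℕ (to f x)

  label-injective : ∀ {x y} → label x ≡ label y → x ≡ y
  label-injective eq = Bijection.injective f (FP.toℕ-injective eq)

  vertex : Fin P → Fin P
  vertex v = fromℕ< (verticesLow v)

  toℕ-vertex : ∀ v → toℕ (vertex v) ≡ label (inj₁ v)
  toℕ-vertex v = FP.toℕ-fromℕ< (verticesLow v)

  vertex-injective : Injective _≡_ _≡_ vertex
  vertex-injective {x} {y} eq with label-injective (trans (sym (toℕ-vertex x)) (trans (cong toℕ eq) (toℕ-vertex y)))
  ... | refl = refl

  -- a label below p is already taken by a vertex, so edge labels are at least p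
  edge-large : ∀ e → P ≤ label (inj₂ e)
  edge-large e with label (inj₂ e) <? P
  ... | no ≮P = ≮⇒≥ ≮P
  ... | yes <P with injective⇒surjective vertex-injective (fromℕ< <P)
  ... | v , eq with label-injective (trans (sym (toℕ-vertex v)) (trans (cong toℕ eq) (FP.toℕ-fromℕ< <P)))
  ... | ()

  edge-small : ∀ e → label (inj₂ e) ∸ P < q G
  edge-small e = +-cancelˡ-< P _ _
    (subst (_< P + q G) (sym (m+[n∸m]≡n (edge-large e))) (FP.toℕ<n (to f (inj₂ e))))

  edge′ : Fin (q G) → Fin (q G)
  edge′ e = fromℕ< (edge-small e)

  toℕ-edge : ∀ e → P + toℕ (edge′ e) ≡ label (inj₂ e)
  toℕ-edge e = trans (cong (P +_) (FP.toℕ-fromℕ< (edge-small e))) (m+[n∸m]≡n (edge-large e))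

  edge-injective : Injective _≡_ _≡_ edge′
  edge-injective {x} {y} eq with label-injective
    (trans (sym (toℕ-edge x)) (trans (cong (λ l → P + toℕ l) eq) (toℕ-edge y)))
  ... | refl = refl

  seperm : SEPerm G k
  seperm = record
    { φ     = permutation vertex vertex-injective
    ; ε     = permutation edge′ edge-injective
    ; magic = λ e → trans (cong₃ (λ a l b → suc a + suc l + suc b)
                                 (toℕ-vertex (proj₁ (edge G e))) (toℕ-edge e) (toℕ-vertex (proj₂ (edge G e))))
                          (valence e)
    }

SELabeling⇒SEPerm : ∀ {G k} → SELabeling G k → SEPerm G k
SELabeling⇒SEPerm L = PermutationForm.seperm L

-- Double counting: for a labeling in permutation form of a loopless graph,
--   Σ_u deg(u)·φ(u) + Σ_{i=p+1}^{p+q} i = Σ_{e} (valence at e) = q·k.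
numer-magic : ∀ {G k} → Loopless G → (L : SEPerm G k) → numer G (SEPerm.φ L) ≡ q G * k
numer-magic {G} {k} loopless L = begin
  sum (map (λ u → deg G u * w u) (allFin P)) + sum (map (λ i → P + suc i) (upTo Q))
    ≡⟨ cong₂ _+_ (sum-allFin P (λ u → deg G u * w u)) (sum-upTo Q (λ i → P + suc i)) ⟩
  ∑ (λ u → deg G u * w u) + ∑ {Q} (λ i → P + suc (toℕ i))
    ≡⟨ cong₂ _+_ (handshake (edges G) loopless w) (∑-permute (λ i → P + suc (toℕ i)) (⤖⇒↔ ε)) ⟩
  sum (map (λ e → w (proj₁ e) + w (proj₂ e)) (edges G)) + ∑ (λ e → P + suc (toℕ (to ε e)))
    ≡⟨ cong (_+ ∑ (λ e → P + suc (toℕ (to ε e)))) (sum-lookup (edges G) (λ e → w (proj₁ e) + w (proj₂ e))) ⟩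
  ∑ (λ e → ends e) + ∑ (λ e → P + suc (toℕ (to ε e)))
    ≡⟨ ∑-distrib-+ ends (λ e → P + suc (toℕ (to ε e))) ⟨
  ∑ (λ e → ends e + (P + suc (toℕ (to ε e))))
    ≡⟨ sum-cong-≗ (λ e → trans (regroup (w (proj₁ (edge G e))) (w (proj₂ (edge G e))) (toℕ (to ε e))) (magic e)) ⟩
  ∑ {Q} (λ _ → k)
    ≡⟨ ∑-const Q k ⟩
  Q * k ∎
  where
  open ≡-Reasoning
  open SEPerm L
  P = p G
  Q = q G
  w : Fin P → ℕ
  w = vertexLabel
  ends : Fin Q → ℕ
  ends e = w (proj₁ (edge G e)) + w (proj₂ (edge G e))
  regroup : ∀ a b l → a + b + (P + suc l) ≡ a + suc (P + l) + b
  regroup a b l = solve 4 (λ P a b l → a :+ b :+ (P :+ (con 1 :+ l)) := a :+ (con 1 :+ (P :+ l)) :+ b) refl P a b l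
    where open +-*-Solver

SEPerm⇒InSigma : ∀ {G k} → Loopless G → SEPerm G k → InSigma G k
SEPerm⇒InSigma loopless L =
  ((φ , ≤-reflexive numer≡) , (φ , ≤-reflexive (sym numer≡))) , SEPerm⇒SELabeling L
  where
  open SEPerm L
  numer≡ = numer-magic loopless L

edgeless-SEPerm : ∀ {G} → q G ≡ 0 → ∀ k → SEPerm G k
edgeless-SEPerm {G} q≡0 k = record
  { φ     = permutation id id
  ; ε     = permutation id id
  ; magic = λ e → ⊥-elim (no-edge e)
  }
  where
  no-edge : Fin (q G) → ⊥
  no-edge e with subst Fin q≡0 e
  ... | ()

-- Each of the three labels on an edge is positive, so a valence is at least 3.
valence≥3 : ∀ {G k} → Fin (q G) → SEPerm G k → 3 ≤ k
valence≥3 e L = subst (3 ≤_) (SEPerm.magic L e) (+-mono-≤ (+-mono-≤ (s≤s z≤n) (s≤s z≤n)) (s≤s z≤n))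

lookup-injective : ∀ {A : Set} {xs : List A} → Unique xs → ∀ {i j} → lookup xs i ≡ lookup xs j → i ≡ j
lookup-injective {xs = x ∷ xs} (x∉ ∷ u) {zero}  {zero}  eq = refl
lookup-injective {xs = x ∷ xs} (x∉ ∷ u) {zero}  {suc j} eq = ⊥-elim (All.lookup x∉ (MP.∈-lookup j) eq)
lookup-injective {xs = x ∷ xs} (x∉ ∷ u) {suc i} {zero}  eq = ⊥-elim (All.lookup x∉ (MP.∈-lookup i) (sym eq))
lookup-injective {xs = x ∷ xs} (x∉ ∷ u) {suc i} {suc j} eq = cong suc (lookup-injective u eq)

concatMap-unique : ∀ {A B : Set} (F : A → List B) (R : A → B → Set) →
                   (∀ {x x′ y} → R x y → R x′ y → x ≡ x′) → (∀ x {y} → y ∈ F x → R x y) →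
                   (∀ x → Unique (F x)) → ∀ {xs} → Unique xs → Unique (concatMap F xs)
concatMap-unique F R functional belongs F-unique {[]}     []       = []
concatMap-unique F R functional belongs F-unique {x ∷ xs} (x∉ ∷ u) =
  UP.++⁺ (F-unique x) (concatMap-unique F R functional belongs F-unique u) disjoint
  where
  disjoint : ∀ {y} → ¬ (y ∈ F x × y ∈ concatMap F xs)
  disjoint (y∈Fx , y∈rest) = AllP.All¬⇒¬Any x∉
    (Any.map (λ y∈Fx′ → functional (belongs x y∈Fx) (belongs _ y∈Fx′)) (MP.∈-concatMap⁻ F y∈rest))

module BipartiteEdges {s t : ℕ} (adj : BipEdges s t) where

  x : Fin s → Fin (s + t)
  x i = i ↑ˡ t

  y : Fin t → Fin (s + t)
  y j = s ↑ʳ j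

  cell : Fin s → Fin t → List (Fin (s + t) × Fin (s + t))
  cell i j = if adj i j then (x i , y j) ∷ [] else []

  row : Fin s → List (Fin (s + t) × Fin (s + t))
  row i = concatMap (cell i) (allFin t)

  cell⁻ : ∀ {i j e} → e ∈ cell i j → adj i j ≡ true × e ≡ (x i , y j)
  cell⁻ {i} {j} e∈ with adj i j
  cell⁻ (here refl) | true = refl , refl

  ∈-edges⁻ : ∀ {e} → e ∈ edges (bipGraph adj) → ∃ λ i → ∃ λ j → adj i j ≡ true × e ≡ (x i , y j)
  ∈-edges⁻ e∈ =
    let i , _ , e∈row  = Mem.find (MP.∈-concatMap⁻ row {allFin s} e∈)
        j , _ , e∈cell = Mem.find (MP.∈-concatMap⁻ (cell i) {allFin t} e∈row)
    in i , j , cell⁻ e∈cell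

  ∈-edges⁺ : ∀ {i j} → adj i j ≡ true → (x i , y j) ∈ edges (bipGraph adj)
  ∈-edges⁺ {i} {j} adjᵢⱼ =
    MP.∈-concatMap⁺ row (Mem.lose (MP.∈-allFin i) (MP.∈-concatMap⁺ (cell i) (Mem.lose (MP.∈-allFin j) in-cell)))
    where
    in-cell : (x i , y j) ∈ cell i j
    in-cell rewrite adjᵢⱼ = here refl

  edges-unique : Unique (edges (bipGraph adj))
  edges-unique = concatMap-unique row (λ i e → proj₁ e ≡ x i)
    (λ e≡xi e≡xi′ → FP.↑ˡ-injective t _ _ (trans (sym e≡xi) e≡xi′))
    (λ i e∈row → let _ , _ , e∈cell = Mem.find (MP.∈-concatMap⁻ (cell i) {allFin t} e∈row)
                 in cong proj₁ (proj₂ (cell⁻ e∈cell)))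
    (λ i → concatMap-unique (cell i) (λ j e → proj₂ e ≡ y j)
             (λ e≡yj e≡yj′ → FP.↑ʳ-injective s _ _ (trans (sym e≡yj) e≡yj′))
             (λ j e∈cell → cong proj₂ (proj₂ (cell⁻ e∈cell)))
             (λ j → cell-unique (adj i j)) (UP.allFin⁺ t))
    (UP.allFin⁺ s)
    where
    cell-unique : ∀ {i j} b → Unique (if b then (x i , y j) ∷ [] else [])
    cell-unique true  = [] ∷ []
    cell-unique false = []

  x≢y : ∀ i j → x i ≢ y j
  x≢y i j eq = <⇒≢ (≤-trans (FP.toℕ<n i) (m≤m+n s (toℕ j)))
                    (trans (sym (FP.toℕ-↑ˡ i t)) (trans (cong toℕ eq) (FP.toℕ-↑ʳ s j)))

  loopless : Loopless (bipGraph adj)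
  loopless = All.tabulate λ e∈ → let i , j , _ , e≡ = ∈-edges⁻ e∈ in
    λ loop → x≢y i j (trans (sym (cong proj₁ e≡)) (trans loop (cong proj₂ e≡)))

  ends : (e : Fin (q (bipGraph adj))) → ∃ λ i → ∃ λ j → adj i j ≡ true × edge (bipGraph adj) e ≡ (x i , y j)
  ends e = ∈-edges⁻ (MP.∈-lookup e)

  src : Fin (q (bipGraph adj)) → Fin s
  src e = proj₁ (ends e)

  tgt : Fin (q (bipGraph adj)) → Fin t
  tgt e = proj₁ (proj₂ (ends e))

  adjacent : ∀ e → adj (src e) (tgt e) ≡ true
  adjacent e = proj₁ (proj₂ (proj₂ (ends e)))

  edge≡ : ∀ e → edge (bipGraph adj) e ≡ (x (src e) , y (tgt e))
  edge≡ e = proj₂ (proj₂ (proj₂ (ends e)))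

  ends-injective : ∀ {e e′} → src e ≡ src e′ → tgt e ≡ tgt e′ → e ≡ e′
  ends-injective {e} {e′} src≡ tgt≡ = lookup-injective edges-unique
    (trans (edge≡ e) (trans (cong₂ (λ i j → (x i , y j)) src≡ tgt≡) (sym (edge≡ e′))))

  edgeAt : ∀ {i j} → adj i j ≡ true → Fin (q (bipGraph adj))
  edgeAt adjᵢⱼ = Any.index (∈-edges⁺ adjᵢⱼ)

  ends-edgeAt : ∀ {i j} (adjᵢⱼ : adj i j ≡ true) → src (edgeAt adjᵢⱼ) ≡ i × tgt (edgeAt adjᵢⱼ) ≡ j
  ends-edgeAt {i} {j} adjᵢⱼ =
    FP.↑ˡ-injective t _ _ (cong proj₁ same) , FP.↑ʳ-injective s _ _ (cong proj₂ same)
    where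
    same : (x (src (edgeAt adjᵢⱼ)) , y (tgt (edgeAt adjᵢⱼ))) ≡ (x i , y j)
    same = trans (sym (edge≡ (edgeAt adjᵢⱼ))) (sym (AnyP.lookup-index (∈-edges⁺ adjᵢⱼ)))


-- The copy pattern of the edges over x_iy_j in S_{2n}: copy r of the edge joins
-- x_i (copy 0) to y_j^r if x_iy_j ∈ H₁, and x_i^r to y_j (copy 0) otherwise.
copyPair : ∀ {n} → Bool → Fin (suc n) → Fin (suc n) × Fin (suc n)
copyPair true  r = zero , r
copyPair false r = r , zero

copyPair-injective : ∀ {n m m′} {r r′ : Fin (suc n)} → m ≡ m′ → copyPair m r ≡ copyPair m′ r′ → r ≡ r′
copyPair-injective {m = true}  refl eq = cong proj₂ eq
copyPair-injective {m = false} refl eq = cong proj₁ eq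

module S2nStructure (n : ℕ) {s t : ℕ} (M M₁ M₂ : BipEdges s t) (dec : Decomposition M M₁ M₂) where

  N : ℕ
  N = suc n

  G H : Graph
  G = bipGraph M
  H = bipGraph (S2n n M M₁ M₂)

  module EG = BipartiteEdges M
  module EH = BipartiteEdges (S2n n M M₁ M₂)

  over : Fin N × Fin s → Fin N × Fin t → Bool
  over (zero  , i) (zero  , j) = M i j
  over (zero  , i) (suc _ , j) = M₁ i j
  over (suc _ , i) (zero  , j) = M₂ i j
  over (suc _ , i) (suc _ , j) = false

  S2n≡over : ∀ A B → S2n n M M₁ M₂ A B ≡ over (remQuot {N} s A) (remQuot {N} t B)
  S2n≡over A B with remQuot {N} s A | remQuot {N} t B
  ... | zero  , i | zero  , j = refl
  ... | zero  , i | suc _ , j = refl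
  ... | suc _ , i | zero  , j = refl
  ... | suc _ , i | suc _ , j = refl

  H₁⊆G : ∀ {i j} → M₁ i j ≡ true → M i j ≡ true
  H₁⊆G {i} {j} h = trans (proj₁ (dec i j)) (cong (_∨ M₂ i j) h)

  H₂⊆G : ∀ {i j} → M₂ i j ≡ true → M i j ≡ true
  H₂⊆G {i} {j} h = trans (proj₁ (dec i j)) (trans (cong (M₁ i j ∨_) h) (∨-zeroʳ (M₁ i j)))

  H₂-not-H₁ : ∀ {i j} → M₂ i j ≡ true → M₁ i j ≡ false
  H₂-not-H₁ {i} {j} h = trans (sym (∧-identityʳ (M₁ i j))) (trans (cong (M₁ i j ∧_) (sym h)) (proj₂ (dec i j)))

  G-not-H₁ : ∀ {i j} → M i j ≡ true → M₁ i j ≡ false → M₂ i j ≡ true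
  G-not-H₁ {i} {j} g h = trans (sym (∨-identityˡ (M₂ i j)))
                               (trans (cong (_∨ M₂ i j) (sym h)) (trans (sym (proj₁ (dec i j))) g))

  over⁻ : ∀ {a i b j} → over (a , i) (b , j) ≡ true →
          M i j ≡ true × ∃ λ r → (a , b) ≡ copyPair (M₁ i j) r
  over⁻ {zero}  {i} {zero}  {j} h = h , zero , copyPair-zero (M₁ i j)
    where
    copyPair-zero : ∀ m → (zero , zero) ≡ copyPair {n} m zero
    copyPair-zero true  = refl
    copyPair-zero false = refl
  over⁻ {zero}  {i} {suc b} {j} h = H₁⊆G h , suc b , cong (λ m → copyPair m (suc b)) (sym h)
  over⁻ {suc a} {i} {zero}  {j} h = H₂⊆G h , suc a , cong (λ m → copyPair m (suc a)) (sym (H₂-not-H₁ h))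
  over⁻ {suc a} {i} {suc b} {j} ()

  over⁺ : ∀ {i j} m → M₁ i j ≡ m → (r : Fin N) → M i j ≡ true →
          over (proj₁ (copyPair m r) , i) (proj₂ (copyPair m r) , j) ≡ true
  over⁺ true  h₁ zero    g = g
  over⁺ true  h₁ (suc r) g = h₁
  over⁺ false h₁ zero    g = g
  over⁺ false h₁ (suc r) g = G-not-H₁ g h₁

  split : Fin (p H) → Fin N × Fin (p G)
  split w with splitAt (N * s) w
  ... | inj₁ A = proj₁ (remQuot {N} s A) , EG.x (proj₂ (remQuot {N} s A))
  ... | inj₂ B = proj₁ (remQuot {N} t B) , EG.y (proj₂ (remQuot {N} t B))

  merge : Fin N × Fin (p G) → Fin (p H)
  merge (a , v) with splitAt s v
  ... | inj₁ i = EH.x (combine a i)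
  ... | inj₂ j = EH.y (combine a j)

  merge-x : ∀ a i → merge (a , EG.x i) ≡ EH.x (combine a i)
  merge-x a i rewrite FP.splitAt-↑ˡ s i t = refl

  merge-y : ∀ a j → merge (a , EG.y j) ≡ EH.y (combine a j)
  merge-y a j rewrite FP.splitAt-↑ʳ s t j = refl

  merge-split : ∀ w → merge (split w) ≡ w
  merge-split w with splitAt (N * s) w in eq
  ... | inj₁ A = begin
    merge (proj₁ (remQuot {N} s A) , EG.x (proj₂ (remQuot {N} s A)))  ≡⟨ merge-x _ _ ⟩
    EH.x (combine (proj₁ (remQuot {N} s A)) (proj₂ (remQuot {N} s A))) ≡⟨ cong EH.x (FP.combine-remQuot {N} s A) ⟩
    join (N * s) (N * t) (inj₁ A)                               ≡⟨ cong (join (N * s) (N * t)) eq ⟨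
    join (N * s) (N * t) (splitAt (N * s) w)                    ≡⟨ FP.join-splitAt (N * s) (N * t) w ⟩
    w                                                           ∎
    where open ≡-Reasoning
  ... | inj₂ B = begin
    merge (proj₁ (remQuot {N} t B) , EG.y (proj₂ (remQuot {N} t B)))  ≡⟨ merge-y _ _ ⟩
    EH.y (combine (proj₁ (remQuot {N} t B)) (proj₂ (remQuot {N} t B))) ≡⟨ cong EH.y (FP.combine-remQuot {N} t B) ⟩
    join (N * s) (N * t) (inj₂ B)                               ≡⟨ cong (join (N * s) (N * t)) eq ⟨
    join (N * s) (N * t) (splitAt (N * s) w)                    ≡⟨ FP.join-splitAt (N * s) (N * t) w ⟩
    w                                                           ∎
    where open ≡-Reasoning

  split-injective : Injective _≡_ _≡_ split
  split-injective {w} {w′} eq = trans (sym (merge-split w)) (trans (cong merge eq) (merge-split w′))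

  split-x : ∀ A → split (EH.x A) ≡ (proj₁ (remQuot {N} s A) , EG.x (proj₂ (remQuot {N} s A)))
  split-x A rewrite FP.splitAt-↑ˡ (N * s) A (N * t) = refl

  split-y : ∀ B → split (EH.y B) ≡ (proj₁ (remQuot {N} t B) , EG.y (proj₂ (remQuot {N} t B)))
  split-y B rewrite FP.splitAt-↑ʳ (N * s) (N * t) B = refl

  srcCopy tgtCopy : Fin (q H) → Fin N
  srcCopy e = proj₁ (remQuot {N} s (EH.src e))
  tgtCopy e = proj₁ (remQuot {N} t (EH.tgt e))

  srcBase : Fin (q H) → Fin s
  srcBase e = proj₂ (remQuot {N} s (EH.src e))

  tgtBase : Fin (q H) → Fin t
  tgtBase e = proj₂ (remQuot {N} t (EH.tgt e))

  lies-over : ∀ e → M (srcBase e) (tgtBase e) ≡ true ×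
                    ∃ λ r → (srcCopy e , tgtCopy e) ≡ copyPair (M₁ (srcBase e) (tgtBase e)) r
  lies-over e = over⁻ (trans (sym (S2n≡over (EH.src e) (EH.tgt e))) (EH.adjacent e))

  base : Fin (q H) → Fin (q G)
  base e = EG.edgeAt (proj₁ (lies-over e))

  copy : Fin (q H) → Fin N
  copy e = proj₁ (proj₂ (lies-over e))

  copies≡ : ∀ e → (srcCopy e , tgtCopy e) ≡ copyPair (M₁ (srcBase e) (tgtBase e)) (copy e)
  copies≡ e = proj₂ (proj₂ (lies-over e))

  base-ends : ∀ e → EG.src (base e) ≡ srcBase e × EG.tgt (base e) ≡ tgtBase e
  base-ends e = EG.ends-edgeAt (proj₁ (lies-over e))

  base-copy-injective : ∀ {e e′} → base e ≡ base e′ → copy e ≡ copy e′ → e ≡ e′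
  base-copy-injective {e} {e′} base≡ copy≡ = EH.ends-injective
    (trans (sym (FP.combine-remQuot {N} s (EH.src e)))
           (trans (cong₂ combine (cong proj₁ copies≡′) src≡) (FP.combine-remQuot {N} s (EH.src e′))))
    (trans (sym (FP.combine-remQuot {N} t (EH.tgt e)))
           (trans (cong₂ combine (cong proj₂ copies≡′) tgt≡) (FP.combine-remQuot {N} t (EH.tgt e′))))
    where
    src≡ : srcBase e ≡ srcBase e′
    src≡ = trans (sym (proj₁ (base-ends e))) (trans (cong EG.src base≡) (proj₁ (base-ends e′)))
    tgt≡ : tgtBase e ≡ tgtBase e′
    tgt≡ = trans (sym (proj₂ (base-ends e))) (trans (cong EG.tgt base≡) (proj₂ (base-ends e′)))
    copies≡′ : (srcCopy e , tgtCopy e) ≡ (srcCopy e′ , tgtCopy e′)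
    copies≡′ = trans (copies≡ e)
                     (trans (cong₃ (λ i j r → copyPair (M₁ i j) r) src≡ tgt≡ copy≡) (sym (copies≡ e′)))

  lift : Fin (q G) → Fin N → Fin (q H)
  lift g r = EH.edgeAt (trans (S2n≡over A B)
                               (trans (cong₂ over (FP.remQuot-combine a i) (FP.remQuot-combine b j))
                                      (over⁺ (M₁ i j) refl r (EG.adjacent g))))
    where
    i = EG.src g
    j = EG.tgt g
    a = proj₁ (copyPair (M₁ i j) r)
    b = proj₂ (copyPair (M₁ i j) r)
    A = combine a i
    B = combine b j

  lift-injective : ∀ {g g′ r r′} → lift g r ≡ lift g′ r′ → g ≡ g′ × r ≡ r′
  lift-injective {g} {g′} {r} {r′} eq =
    g≡ , copyPair-injective (cong (λ h → M₁ (EG.src h) (EG.tgt h)) g≡) copies≡′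
    where
    srcs = FP.combine-injective _ _ _ _
             (trans (sym (proj₁ (EH.ends-edgeAt _))) (trans (cong EH.src eq) (proj₁ (EH.ends-edgeAt _))))
    tgts = FP.combine-injective _ _ _ _
             (trans (sym (proj₂ (EH.ends-edgeAt _))) (trans (cong EH.tgt eq) (proj₂ (EH.ends-edgeAt _))))
    g≡ : g ≡ g′
    g≡ = EG.ends-injective (proj₂ srcs) (proj₂ tgts)
    copies≡′ = cong₂ _,_ (proj₁ srcs) (proj₁ tgts)

  edge-count : q H ≡ q G * N
  edge-count = FP.cantor-schröder-bernstein
    {f = λ e → combine (base e) (copy e)}
    {g = λ y → lift (proj₁ (remQuot {q G} N y)) (proj₂ (remQuot {q G} N y))}
    (λ eq → let base≡ , copy≡ = FP.combine-injective _ _ _ _ eq in base-copy-injective base≡ copy≡)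
    (λ {y} {y′} eq → let g≡ , r≡ = lift-injective eq in
       trans (sym (FP.combine-remQuot {q G} N y)) (trans (cong₂ combine g≡ r≡) (FP.combine-remQuot {q G} N y′)))

liftedValence : (n k : ℕ) → Fin (suc n) → ℕ
liftedValence n k c = (n + 3) + (toℕ c + (k ∸ 3) * suc n)

-- The arithmetic behind K: vertex labels N·X + α and N·Y + β and edge label
-- p_H + N·L + (n − ρ), where α + β = γ + ρ.
lifted-arith : ∀ n s t X Y L α β γ ρ → α + β ≡ γ + ρ → ρ ≤ n →
  suc (suc n * X + α) + suc ((suc n * s + suc n * t) + (suc n * L + (n ∸ ρ))) + suc (suc n * Y + β)
  ≡ (n + 3) + (γ + (X + (s + t + L) + Y) * suc n)
lifted-arith n s t X Y L α β γ ρ αβ ρ≤n = begin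
  suc (suc n * X + α) + suc ((suc n * s + suc n * t) + (suc n * L + (n ∸ ρ))) + suc (suc n * Y + β)
    ≡⟨ expand n s t X Y L α β (n ∸ ρ) ⟩
  (α + β) + (n ∸ ρ) + 3 + W * suc n
    ≡⟨ cong (λ z → z + (n ∸ ρ) + 3 + W * suc n) αβ ⟩
  (γ + ρ) + (n ∸ ρ) + 3 + W * suc n
    ≡⟨ cong (λ z → z + 3 + W * suc n) (trans (+-assoc γ ρ (n ∸ ρ)) (cong (γ +_) (m+[n∸m]≡n ρ≤n))) ⟩
  γ + n + 3 + W * suc n
    ≡⟨ collect n γ W ⟩
  (n + 3) + (γ + W * suc n) ∎
  where
  open ≡-Reasoning
  open +-*-Solver
  W = X + (s + t + L) + Y
  expand : ∀ n s t X Y L α β d →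
    suc (suc n * X + α) + suc ((suc n * s + suc n * t) + (suc n * L + d)) + suc (suc n * Y + β)
    ≡ (α + β) + d + 3 + (X + (s + t + L) + Y) * suc n
  expand = solve 9 (λ n s t X Y L α β d →
    (con 1 :+ ((con 1 :+ n) :* X :+ α))
      :+ (con 1 :+ (((con 1 :+ n) :* s :+ (con 1 :+ n) :* t) :+ ((con 1 :+ n) :* L :+ d)))
      :+ (con 1 :+ ((con 1 :+ n) :* Y :+ β))
    := (α :+ β) :+ d :+ con 3 :+ (X :+ (s :+ t :+ L) :+ Y) :* (con 1 :+ n)) refl
  collect : ∀ n γ W → γ + n + 3 + W * suc n ≡ (n + 3) + (γ + W * suc n)
  collect = solve 3 (λ n γ W → γ :+ n :+ con 3 :+ W :* (con 1 :+ n) := (n :+ con 3) :+ (γ :+ W :* (con 1 :+ n))) refl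

valence∸3 : ∀ a b c → suc a + suc b + suc c ∸ 3 ≡ a + b + c
valence∸3 a b c = trans (cong (_∸ 3) (three+ a b c)) (m+n∸m≡n 3 (a + b + c))
  where
  open +-*-Solver
  three+ : ∀ a b c → suc a + suc b + suc c ≡ 3 + (a + b + c)
  three+ = solve 3 (λ a b c → (con 1 :+ a) :+ (con 1 :+ b) :+ (con 1 :+ c) := con 3 :+ (a :+ b :+ c)) refl

module Lifting (n : ℕ) {s t : ℕ} (M M₁ M₂ : BipEdges s t) (dec : Decomposition M M₁ M₂)
               {k : ℕ} (L : SEPerm (bipGraph M) k) (c : Fin (suc n)) where

  open S2nStructure n M M₁ M₂ dec
  open SEPerm L

  τ : Fin N → Fin N
  τ = PC.transpose zero c

  τ-injective : Injective _≡_ _≡_ τ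
  τ-injective {a} {b} eq = trans (sym (Perm.inverseˡ π)) (trans (cong (π Perm.⟨$⟩ˡ_) eq) (Perm.inverseˡ π))
    where π = Perm.transpose zero c

  τ-copyPair : ∀ m r → toℕ (τ (proj₁ (copyPair m r))) + toℕ (τ (proj₂ (copyPair m r))) ≡ toℕ c + toℕ (τ r)
  τ-copyPair true  r = refl
  τ-copyPair false r = +-comm (toℕ (τ r)) (toℕ c)

  vertexH : Fin (p H) → Fin (p H)
  vertexH w = cast (trans (*-comm (s + t) N) (*-distribˡ-+ N s t))
                   (combine (to φ (proj₂ (split w))) (τ (proj₁ (split w))))

  toℕ-vertexH : ∀ w → toℕ (vertexH w) ≡ N * toℕ (to φ (proj₂ (split w))) + toℕ (τ (proj₁ (split w)))
  toℕ-vertexH w = trans (FP.toℕ-cast _ _) (FP.toℕ-combine (to φ (proj₂ (split w))) (τ (proj₁ (split w))))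

  vertexH-injective : Injective _≡_ _≡_ vertexH
  vertexH-injective {w} {w′} eq =
    let φ≡ , τ≡ = FP.combine-injective _ _ _ _ (cast-injective _ eq)
    in split-injective (cong₂ _,_ (τ-injective τ≡) (Bijection.injective φ φ≡))

  edgeH : Fin (q H) → Fin (q H)
  edgeH e = cast (sym edge-count) (combine (to ε (base e)) (opposite (τ (copy e))))

  toℕ-edgeH : ∀ e → toℕ (edgeH e) ≡ N * toℕ (to ε (base e)) + (n ∸ toℕ (τ (copy e)))
  toℕ-edgeH e = trans (FP.toℕ-cast _ _)
    (trans (FP.toℕ-combine (to ε (base e)) (opposite (τ (copy e))))
           (cong (N * toℕ (to ε (base e)) +_) (FP.opposite-prop (τ (copy e)))))

  edgeH-injective : Injective _≡_ _≡_ edgeH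
  edgeH-injective eq =
    let ε≡ , opp≡ = FP.combine-injective _ _ _ _ (cast-injective _ eq)
    in base-copy-injective (Bijection.injective ε ε≡) (τ-injective (opposite-injective opp≡))

  toℕ-vertexH-x : ∀ A → toℕ (vertexH (EH.x A))
                        ≡ N * toℕ (to φ (EG.x (proj₂ (remQuot {N} s A)))) + toℕ (τ (proj₁ (remQuot {N} s A)))
  toℕ-vertexH-x A = trans (toℕ-vertexH (EH.x A))
    (cong (λ av → N * toℕ (to φ (proj₂ av)) + toℕ (τ (proj₁ av))) (split-x A))

  toℕ-vertexH-y : ∀ B → toℕ (vertexH (EH.y B))
                        ≡ N * toℕ (to φ (EG.y (proj₂ (remQuot {N} t B)))) + toℕ (τ (proj₁ (remQuot {N} t B)))
  toℕ-vertexH-y B = trans (toℕ-vertexH (EH.y B))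
    (cong (λ av → N * toℕ (to φ (proj₂ av)) + toℕ (τ (proj₁ av))) (split-y B))

  magicH : ∀ e → suc (toℕ (vertexH (proj₁ (edge H e)))) + suc (p H + toℕ (edgeH e))
                 + suc (toℕ (vertexH (proj₂ (edge H e)))) ≡ liftedValence n k c
  magicH e = begin
    suc (toℕ (vertexH (proj₁ (edge H e)))) + suc (p H + toℕ (edgeH e)) + suc (toℕ (vertexH (proj₂ (edge H e))))
      ≡⟨ cong₂ (λ u v → suc (toℕ (vertexH u)) + suc (p H + toℕ (edgeH e)) + suc (toℕ (vertexH v)))
               (cong proj₁ (EH.edge≡ e)) (cong proj₂ (EH.edge≡ e)) ⟩
    suc (toℕ (vertexH (EH.x (EH.src e)))) + suc (p H + toℕ (edgeH e)) + suc (toℕ (vertexH (EH.y (EH.tgt e))))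
      ≡⟨ cong₃ (λ u l v → suc u + suc (p H + l) + suc v)
               (toℕ-vertexH-x (EH.src e)) (toℕ-edgeH e) (toℕ-vertexH-y (EH.tgt e)) ⟩
    suc (N * X + τ₁) + suc (p H + (N * ℓ + (n ∸ toℕ (τ (copy e))))) + suc (N * Y + τ₂)
      ≡⟨ lifted-arith n s t X Y ℓ τ₁ τ₂ (toℕ c) (toℕ (τ (copy e))) shifts
                      (s≤s⁻¹ (FP.toℕ<n (τ (copy e)))) ⟩
    (n + 3) + (toℕ c + (X + (s + t + ℓ) + Y) * N)
      ≡⟨ cong (λ w → (n + 3) + (toℕ c + w * N))
              (trans (sym (valence∸3 X (s + t + ℓ) Y)) (cong (_∸ 3) base-magic)) ⟩
    liftedValence n k c ∎
    where
    open ≡-Reasoning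
    g = base e
    X = toℕ (to φ (EG.x (srcBase e)))
    Y = toℕ (to φ (EG.y (tgtBase e)))
    ℓ = toℕ (to ε g)
    τ₁ = toℕ (τ (srcCopy e))
    τ₂ = toℕ (τ (tgtCopy e))
    shifts : τ₁ + τ₂ ≡ toℕ c + toℕ (τ (copy e))
    shifts = trans (cong (λ ab → toℕ (τ (proj₁ ab)) + toℕ (τ (proj₂ ab))) (copies≡ e))
                   (τ-copyPair (M₁ (srcBase e) (tgtBase e)) (copy e))
    base-magic : suc X + suc (s + t + ℓ) + suc Y ≡ k
    base-magic = trans
      (cong₂ (λ u v → suc (toℕ (to φ u)) + edgeLabel g + suc (toℕ (to φ v)))
             (sym (trans (cong proj₁ (EG.edge≡ g)) (cong EG.x (proj₁ (base-ends e)))))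
             (sym (trans (cong proj₂ (EG.edge≡ g)) (cong EG.y (proj₂ (base-ends e))))))
      (magic g)

  liftedSEPerm : SEPerm H (liftedValence n k c)
  liftedSEPerm = record
    { φ     = permutation vertexH vertexH-injective
    ; ε     = permutation edgeH edgeH-injective
    ; magic = magicH
    }

quotRem-injective : ∀ {n x y} {c c′ : Fin (suc n)} → toℕ c + x * suc n ≡ toℕ c′ + y * suc n → x ≡ y × c ≡ c′
quotRem-injective {n} {x} {y} {c} {c′} eq =
  trans (sym (quotient c x)) (trans (cong (_/ suc n) eq) (quotient c′ y)) ,
  FP.toℕ-injective (trans (sym (remainder c x)) (trans (cong (_% suc n) eq) (remainder c′ y)))
  where
  quotient : ∀ (c : Fin (suc n)) x → (toℕ c + x * suc n) / suc n ≡ x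
  quotient c x = trans (+-distrib-/-∣ʳ (toℕ c) (n∣m*n x))
                       (cong₂ _+_ (m<n⇒m/n≡0 (FP.toℕ<n c)) (m*n/n≡m x (suc n)))
  remainder : ∀ (c : Fin (suc n)) x → (toℕ c + x * suc n) % suc n ≡ toℕ c
  remainder c x = trans ([m+kn]%n≡m%n (toℕ c) x (suc n)) (m<n⇒m%n≡m (FP.toℕ<n c))

spread : (n d : ℕ) → List ℕ → List ℕ
spread n d xs = cartesianProductWith (λ x (c : Fin (suc n)) → d + (toℕ c + x * suc n)) xs (allFin (suc n))

spread-unique : ∀ n d {xs} → Unique xs → Unique (spread n d xs)
spread-unique n d xs-unique = UP.cartesianProductWith⁺ _
  (λ {x} {x′} eq → quotRem-injective {n} {x} {x′} (+-cancelˡ-≡ d _ _ eq)) xs-unique (UP.allFin⁺ (suc n))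

spread-length : ∀ n d xs → length (spread n d xs) ≡ suc n * length xs
spread-length n d []       = sym (*-zeroʳ (suc n))
spread-length n d (x ∷ xs) = begin
  length (map shift (allFin (suc n)) ++ spread n d xs)
    ≡⟨ LP.length-++ (map shift (allFin (suc n))) ⟩
  length (map shift (allFin (suc n))) + length (spread n d xs)
    ≡⟨ cong₂ _+_ (trans (LP.length-map shift (allFin (suc n))) (LP.length-tabulate {n = suc n} id))
                 (spread-length n d xs) ⟩
  suc n + suc n * length xs
    ≡⟨ *-suc (suc n) (length xs) ⟨
  suc n * length (x ∷ xs) ∎
  where
  open ≡-Reasoning
  shift : Fin (suc n) → ℕ
  shift c = d + (toℕ c + x * suc n)

spread-all : ∀ n d {P : ℕ → Set} {xs} → All (λ x → ∀ (c : Fin (suc n)) → P (d + (toℕ c + x * suc n))) xs →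
             All P (spread n d xs)
spread-all n d              []         = []
spread-all n d {xs = x ∷ _} (px ∷ pxs) =
  AllP.++⁺ (AllP.map⁺ {f = λ c → d + (toℕ c + x * suc n)} (AllP.tabulate⁺ {f = id} px)) (spread-all n d pxs)

map-unique : ∀ {A B : Set} {P : A → Set} {f : A → B} → (∀ {x y} → P x → P y → f x ≡ f y → x ≡ y) →
             ∀ {xs} → All P xs → Unique xs → Unique (map f xs)
map-unique inj []         []       = []
map-unique inj (px ∷ pxs) (x∉ ∷ u) =
  AllP.map⁺ (All.zipWith (λ (py , x≢y) fx≡fy → x≢y (inj px py fx≡fy)) (pxs , x∉)) ∷ map-unique inj pxs u

lifted-valences : ∀ n {s t} (M M₁ M₂ : BipEdges s t) → Decomposition M M₁ M₂ →
                  ∀ {k} → InSigma (bipGraph M) k → ∀ c → InSigma (bipGraph (S2n n M M₁ M₂)) (liftedValence n k c)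
lifted-valences n M M₁ M₂ dec σk c = SEPerm⇒InSigma (BipartiteEdges.loopless (S2n n M M₁ M₂))
  (Lifting.liftedSEPerm n M M₁ M₂ dec (SELabeling⇒SEPerm (proj₂ σk)) c)

-- If G has no edges, neither has S_{2n}, so every natural number lies in σ_{S_{2n}}.
edgeless-valences : ∀ n {s t} (M M₁ M₂ : BipEdges s t) → Decomposition M M₁ M₂ →
                    q (bipGraph M) ≡ 0 → ∀ K → InSigma (bipGraph (S2n n M M₁ M₂)) K
edgeless-valences n M M₁ M₂ dec no-edge K =
  SEPerm⇒InSigma EH.loopless (edgeless-SEPerm (trans edge-count (cong (_* N) no-edge)) K)
  where open S2nStructure n M M₁ M₂ dec

σ-valence≥3 : ∀ {G k} → q G ≢ 0 → InSigma G k → 3 ≤ k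
σ-valence≥3 q≢0 σk = valence≥3 (fromℕ< (n≢0⇒n>0 q≢0)) (SELabeling⇒SEPerm (proj₂ σk))

-- Theorem 3.5.  For distinct k₁, …, k_ℓ ∈ σ_G the (n+1)ℓ numbers K(kᵢ, c) are
-- distinct elements of σ_{S_{2n}}; K is injective because kᵢ ≥ 3.  (Without
-- edges σ_{S_{2n}} = ℕ and any (n+1)ℓ distinct numbers will do.)
theorem3p5 : ∀ (s t n : ℕ) → 1 ≤ n →
    (M M₁ M₂ : BipEdges s t) → Decomposition M M₁ M₂ →
    SuperEdgeMagic (bipGraph M) →
    SigmaCardGe (bipGraph (S2n n M M₁ M₂)) (suc n) (bipGraph M)
theorem3p5 s t n _ M M₁ M₂ dec _ ks ks-unique ks-σ with q (bipGraph M) ≟ 0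
... | yes no-edge =
  spread n 0 ks ,
  spread-unique n 0 ks-unique ,
  spread-all n 0 (All.map (λ _ c → edgeless-valences n M M₁ M₂ dec no-edge _) ks-σ) ,
  ≤-reflexive (sym (spread-length n 0 ks))
... | no some-edge =
  spread n (n + 3) (map (_∸ 3) ks) ,
  spread-unique n (n + 3) (map-unique ∸-cancelʳ-≡ (All.map (σ-valence≥3 some-edge) ks-σ) ks-unique) ,
  spread-all n (n + 3) (AllP.map⁺ (All.map (lifted-valences n M M₁ M₂ dec) ks-σ)) ,
  ≤-reflexive (sym (trans (spread-length n (n + 3) (map (_∸ 3) ks)) (cong (suc n *_) (LP.length-map (_∸ 3) ks))))
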